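{- There exist a finite alphabet $\Sigma$ and a (real time) Büchi $1$-blind-counter automaton $\mathcal{A}$ with input alphabet $\Sigma$ such that the accepted $\omega$-language $L(\mathcal{A})\subseteq \Sigma^\omega$ is $\mathbf{\Sigma}^0_3$-complete.
   Context: **Words.** For a countable alphabet $X$, $X^\star$ is the set of finite words over $X$ and $X^\omega$ the set of infinite words ($\omega$-words, i.e. sequences of type $\omega$) over $X$. An $\omega$-language over $X$ is a subset of $X^\omega$. **Automata.** A (real time) Büchi $1$-blind-counter automaton is a 5-tuple $\mathcal{A}=(Q,\Sigma,\Delta,q_0,F)$, where $Q$ is a finite set of states, $\Sigma$ is a finite input alphabet, $q_0\in Q$ is the initial state, $\Delta\subseteq Q\times\Sigma\times\{0,1\}\times Q\times\{0,1,-1\}$ is the transition relation, and $F\subseteq Q$ is the set of accepting states. The counter is required to be blind: if $(q,a,0,q',j)\in\Delta$ then also $(q,a,1,q',j)\in\Delta$. (There are no $\varepsilon$-transitions.) A configuration is a pair $(q,c)$ with $q\in Q$ and $c\in\mathbb{N}$ (the content of the counter; $0\in\mathbb{N}$). For $a\in\Sigma$, $q,q'\in Q$, $c\in\mathbb{N}$, we write $a:(q,c)\mapsto_{\mathcal{A}}(q',c+j)$ if there is $i\in\{0,1\}$ such that $(q,a,i,q',j)\in\Delta$, and ($c\geq 1\Rightarrow i=1$), and ($c=0\Rightarrow (i=0$ and $j\in\{0,1\})$). For $x=a_1a_2\ldots\in\Sigma^\omega$, a run of $\mathcal{A}$ on $x$ is an infinite sequence of configurations $\rho=(q_i,c_i)_{i\geq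 1}$ with $(q_1,c_1)=(q_0,0)$ and $a_i:(q_i,c_i)\mapsto_{\mathcal{A}}(q_{i+1},c_{i+1})$ for all $i\geq 1$. Let $In(\rho)$ be the set of states visited infinitely often in $\rho$. The automaton accepts $x$ if there is a run $\rho$ of $\mathcal{A}$ on $x$ with $In(\rho)\cap F\neq\emptyset$. $L(\mathcal{A})$ is the set of $x\in\Sigma^\omega$ accepted by $\mathcal{A}$. **Topology.** For a countable (finite or countably infinite) alphabet $X$ with at least two letters, $X^\omega$ carries the product topology of the discrete topology on $X$. $\mathbf{\Sigma}^0_1$ is the class of open subsets of $X^\omega$, $\mathbf{\Pi}^0_1$ the class of closed subsets, and for $n\geq 1$, $\mathbf{\Sigma}^0_{n+1}$ is the class of countable unions of $\mathbf{\Pi}^0_n$-subsets and $\mathbf{\Pi}^0_{n+1}$ is the class of countable intersections of $\mathbf{\Sigma}^0_n$-subsets of $X^\omega$. A set $A\subseteq X^\omega$ is $\mathbf{\Sigma}^0_n$-hard if for every countable alphabet $Y$ and every $\mathbf{\Sigma}^0_n$ set $E\subseteq Y^\omega$ there is a continuous function $f:Y^\omega\to X^\omega$ with $E=f^{ -1}(A)$. It is $\mathbf{\Sigma}^0_n$-complete if it is $\mathbf{\Sigma}^0_n$-hard and belongs to $\mathbf{\Sigma}^0_n$. -}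

module Defs where

open import Data.Fin using (Fin)
open import Data.Fin.Patterns using (0F; 1F)
open import Data.Integer as ℤ using (ℤ; +_; 0ℤ; 1ℤ; -1ℤ)
open import Data.Nat using (ℕ; suc; _≤_; _<_)
open import Data.Product using (_×_; _,_; proj₁; proj₂; ∃; ∃₂; ∃-syntax)
open import Data.Sum using (_⊎_)
open import Function.Bundles using (_↔_; _↣_)
open import Level using (0ℓ)
open import Relation.Binary.PropositionalEquality using (_≡_; _≢_)
open import Relation.Unary using (Pred; _∈_; _≐_; _≬_; _⊢_; ∁; ⋃; ⋂)

Finite : Set → Set
Finite X = ∃[ n ] X ↔ Fin n

-- Finite or countably infinite.
Countable : Set → Set
Countable X = X ↣ ℕ

AtLeastTwo : Set → Set
AtLeastTwo X = ∃₂ λ (a b : X) → a ≢ b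

infix 30 _^ω

_^ω : Set → Set
X ^ω = ℕ → X

ωLanguage : Set → Set₁
ωLanguage X = Pred (X ^ω) 0ℓ

------------------------------------------------------------------------
-- Real-time Büchi 1-blind-counter automata

data Shift : Set where
  stay inc dec : Shift

⟦_⟧ : Shift → ℤ
⟦ stay ⟧ = 0ℤ
⟦ inc ⟧  = 1ℤ
⟦ dec ⟧  = -1ℤ

-- In Δ q a i q′ j, the flag i is 0F for the transitions available when
-- the counter is zero, and 1F for those available when it is positive.
record BlindCounterAutomaton (Σ : Set) : Set₁ where
  field
    Q        : Set
    Q-finite : Finite Q
    Σ-finite : Finite Σ
    Δ        : Q → Σ → Fin 2 → Q → Shift → Set
    q₀       : Q
    F        : Pred Q 0ℓ
    blind    : ∀ {q a q′ j} → Δ q a 0F q′ j → Δ q a 1F q′ j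

module _ {Σ : Set} (𝒜 : BlindCounterAutomaton Σ) where
  open BlindCounterAutomaton 𝒜

  Config : Set
  Config = Q × ℕ

  Step : Σ → Config → Config → Set
  Step a (q , c) (q′ , c′) = ∃₂ λ (i : Fin 2) (j : Shift) →
      Δ q a i q′ j
    × (1 ≤ c → i ≡ 1F)
    × (c ≡ 0 → i ≡ 0F × (j ≡ stay ⊎ j ≡ inc))
    × + c′ ≡ + c ℤ.+ ⟦ j ⟧

  -- Words and runs are indexed from 0.
  IsRun : Σ ^ω → (ℕ → Config) → Set
  IsRun x ρ = ρ 0 ≡ (q₀ , 0) × (∀ i → Step (x i) (ρ i) (ρ (suc i)))

  In : (ℕ → Config) → Pred Q 0ℓ
  In ρ q = ∀ n → ∃[ m ] n ≤ m × proj₁ (ρ m) ≡ q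

  L : ωLanguage Σ
  L x = ∃[ ρ ] IsRun x ρ × In ρ ≬ F

------------------------------------------------------------------------
-- The product topology and the finite Borel hierarchy

module _ {X : Set} where

  _≈[_]_ : X ^ω → ℕ → X ^ω → Set
  x ≈[ n ] y = ∀ i → i < n → x i ≡ y i

  -- The sets { y | x ≈[ n ] y } form a neighbourhood base at x.  In
  -- particular, open sets respect pointwise equality of ω-words.
  Open : ωLanguage X → Set
  Open U = ∀ x → x ∈ U → ∃[ n ] (∀ y → x ≈[ n ] y → y ∈ U)

  Closed : ωLanguage X → Set
  Closed C = Open (∁ C)

  -- The levels are n ≥ 1; both classes are empty at index 0.
  data Σ⁰ : ℕ → ωLanguage X → Set₁
  data Π⁰ : ℕ → ωLanguage X → Set₁

  data Σ⁰ where
    open-set : ∀ {A} → Open A → Σ⁰ 1 A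
    union    : ∀ {n A} (B : ℕ → ωLanguage X) →
               (∀ k → Π⁰ (suc n) (B k)) → A ≐ ⋃ ℕ B → Σ⁰ (suc (suc n)) A

  data Π⁰ where
    closed-set   : ∀ {A} → Closed A → Π⁰ 1 A
    intersection : ∀ {n A} (B : ℕ → ωLanguage X) →
                   (∀ k → Σ⁰ (suc n) (B k)) → A ≐ ⋂ ℕ B → Π⁰ (suc (suc n)) A

Continuous : {Y X : Set} → (Y ^ω → X ^ω) → Set₁
Continuous f = ∀ U → Open U → Open (f ⊢ U)

Σ⁰-Hard : ℕ → {X : Set} → ωLanguage X → Set₁
Σ⁰-Hard n {X} A =
  ∀ (Y : Set) → Countable Y → AtLeastTwo Y →
  ∀ (E : ωLanguage Y) → Σ⁰ n E →
  ∃ λ (f : Y ^ω → X ^ω) → Continuous f × E ≐ (f ⊢ A)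

Σ⁰-Complete : ℕ → {X : Set} → ωLanguage X → Set₁
Σ⁰-Complete n A = Σ⁰-Hard n A × Σ⁰ n A

{-# OPTIONS --safe #-}

-- The automaton guesses a number n into its counter and then reads blocks
-- enter … leave, whose letters down and up act on the counter; each block may
-- be skipped or used, and infinitely many must be used.
--
-- Membership in Σ⁰₃: a larger counter can imitate a smaller one, so using
-- exactly the blocks which do not lower the counter keeps it maximal.  If this
-- greedy strategy uses only finitely many blocks, then from some moment on each
-- used block lowers the counter, and no run uses infinitely many.  Hence a word
-- is accepted from n iff its greedy strategy gains infinitely often, which is a
-- Π⁰₂ condition.
--
-- Hardness: let E = ⋃ₖ ⋂ₗ Cₖₗ with Cₖₗ open.  The reduction writes a fixed
-- sequence of blocks enter downᵏ⁺¹ upᵏ⁺¹ in which every k recurs, and completes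
-- the block (k , t) by leave iff at time t a new initial part of (Cₖₗ)ₗ is seen
-- to contain the input.  A counter n can use precisely the completed blocks
-- with k < n.

module Submission where

open import Defs
open import Axiom.ExcludedMiddle using (ExcludedMiddle)
open import Data.Empty using (⊥; ⊥-elim)
open import Data.Fin using (Fin)
open import Data.Fin.Patterns using (0F; 1F; 2F; 3F)
open import Data.Integer using (+_)
open import Data.Integer.Properties using (+-injective)
open import Data.Maybe using (Maybe; just; nothing)
open import Data.Maybe.Relation.Unary.All using (All; just; nothing)
open import Data.Nat
open import Data.Nat.Induction using (<-wellFounded)
open import Data.Nat.Properties
open import Data.Product using (∃; ∃₂; ∃-syntax; _×_; _,_; proj₁; proj₂)
open import Data.Sum using (_⊎_; inj₁; inj₂)
open import Function using (_∘_; mk↔ₛ′)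
open import Induction.WellFounded using (Acc; acc)
open import Level using (0ℓ)
open import Relation.Binary.PropositionalEquality
open import Relation.Nullary using (¬_; Dec; yes; no; contradiction)
open import Relation.Unary using (_≐_; ⋂)

Infinitely : (ℕ → Set) → Set
Infinitely P = ∀ m → ∃[ t ] m ≤ t × P t

-- The automaton

data Letter : Set where
  enter down up leave : Letter

data State : Set where
  guess wait use done : State

data Idle : State → Set where
  wait : Idle wait
  done : Idle done

-- Idling always leads to `wait`, so `done` is entered only by completing a block. A run in `use`
-- cannot abandon its block.
data δ : State → Letter → State → Shift → Set where
  increase : ∀ {a} → δ guess a guess inc
  commit   : ∀ {a} → δ guess a wait stay
  skip     : ∀ {q a} → Idle q → δ q a wait stay
  start    : ∀ {q} → Idle q → δ q enter use stay
  lower    : δ use down use dec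
  raise    : δ use up use inc
  finish   : δ use leave done stay

Letter-finite : Finite Letter
Letter-finite = 4 , mk↔ₛ′ to from
  (λ { 0F → refl ; 1F → refl ; 2F → refl ; 3F → refl })
  (λ { enter → refl ; down → refl ; up → refl ; leave → refl })
  where
  to : Letter → Fin 4
  to enter = 0F
  to down  = 1F
  to up    = 2F
  to leave = 3F

  from : Fin 4 → Letter
  from 0F = enter
  from 1F = down
  from 2F = up
  from 3F = leave

State-finite : Finite State
State-finite = 4 , mk↔ₛ′ to from
  (λ { 0F → refl ; 1F → refl ; 2F → refl ; 3F → refl })
  (λ { guess → refl ; wait → refl ; use → refl ; done → refl })
  where
  to : State → Fin 4
  to guess = 0F
  to wait  = 1F
  to use   = 2F
  to done  = 3F

  from : Fin 4 → State
  from 0F = guess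
  from 1F = wait
  from 2F = use
  from 3F = done

𝒜 : BlindCounterAutomaton Letter
𝒜 = record
  { Q        = State
  ; Q-finite = State-finite
  ; Σ-finite = Letter-finite
  -- Only `dec` constrains the flag; the other shifts are available with either flag, whence
  -- blindness.
  ; Δ        = λ q a i q′ j → δ q a q′ j × (j ≡ dec → i ≡ 1F)
  ; q₀       = guess
  ; F        = _≡ done
  ; blind    = λ (d , _) → d , λ _ → refl
  }

-- Flag-free steps and finite paths

data Move : Shift → ℕ → ℕ → Set where
  stay : ∀ {c} → Move stay c c
  inc  : ∀ {c} → Move inc c (suc c)
  dec  : ∀ {c} → Move dec (suc c) c

infix 4 _⊢_⟶_

_⊢_⟶_ : Letter → Config 𝒜 → Config 𝒜 → Set
a ⊢ (q , c) ⟶ (q′ , c′) = ∃[ j ] δ q a q′ j × Move j c c′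

⟶⇒Step : ∀ {a κ κ′} → a ⊢ κ ⟶ κ′ → Step 𝒜 a κ κ′
⟶⇒Step {κ = _ , zero} (_ , d , stay) =
  0F , stay , (d , λ ()) , (λ ()) , (λ _ → refl , inj₁ refl) , refl
⟶⇒Step {κ = _ , zero} (_ , d , inc) =
  0F , inc , (d , λ ()) , (λ ()) , (λ _ → refl , inj₂ refl) , refl
⟶⇒Step {κ = _ , suc c} (_ , d , stay) =
  1F , stay , (d , λ ()) , (λ _ → refl) , (λ ()) , cong +_ (sym (+-identityʳ (suc c)))
⟶⇒Step {κ = _ , suc c} (_ , d , inc) =
  1F , inc , (d , λ ()) , (λ _ → refl) , (λ ()) , cong +_ (+-comm 1 (suc c))
⟶⇒Step {κ = _ , suc c} (_ , d , dec) =
  1F , dec , (d , λ _ → refl) , (λ _ → refl) , (λ ()) , refl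

Step⇒⟶ : ∀ {a κ κ′} → Step 𝒜 a κ κ′ → a ⊢ κ ⟶ κ′
Step⇒⟶ {κ = _ , c} (_ , stay , (d , _) , _ , _ , eq)
  rewrite trans (+-injective eq) (+-identityʳ c) = stay , d , stay
Step⇒⟶ {κ = _ , c} (_ , inc , (d , _) , _ , _ , eq)
  rewrite trans (+-injective eq) (+-comm c 1) = inc , d , inc
Step⇒⟶ {κ = _ , zero} (_ , dec , _ , _ , z , _) with z refl
... | _ , inj₁ ()
... | _ , inj₂ ()
Step⇒⟶ {κ = _ , suc c} (_ , dec , (d , _) , _ , _ , eq)
  rewrite +-injective eq = dec , d , dec

module _ (x : Letter ^ω) where

  infixr 5 _∷_

  data Path : ℕ → Config 𝒜 → ℕ → Config 𝒜 → Set where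
    []  : ∀ {t κ} → Path t κ t κ
    _∷_ : ∀ {t κ κ′ t″ κ″} →
          x t ⊢ κ ⟶ κ′ → Path (suc t) κ′ t″ κ″ → Path t κ t″ κ″

module _ {x : Letter ^ω} where

  infixl 5 _∷ʳ_

  _∷ʳ_ : ∀ {t κ t′ κ′ κ″} → Path x t κ t′ κ′ → x t′ ⊢ κ′ ⟶ κ″ →
         Path x t κ (suc t′) κ″
  []      ∷ʳ s′ = s′ ∷ []
  (s ∷ p) ∷ʳ s′ = s ∷ (p ∷ʳ s′)

  infixr 5 _++_

  _++_ : ∀ {t κ t′ κ′ t″ κ″} →
         Path x t κ t′ κ′ → Path x t′ κ′ t″ κ″ → Path x t κ t″ κ″
  []      ++ p′ = p′
  (s ∷ p) ++ p′ = s ∷ (p ++ p′)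

  uncons : ∀ {t κ t′ κ′} → t ≤ t′ → Path x t κ (suc t′) κ′ →
           ∃[ κ″ ] x t ⊢ κ ⟶ κ″ × Path x (suc t) κ″ (suc t′) κ′
  uncons t≤t′ []      = contradiction t≤t′ 1+n≰n
  uncons _    (s ∷ p) = _ , s , p

  guess-path : ∀ n → Path x 0 (guess , 0) n (guess , n)
  guess-path zero    = []
  guess-path (suc n) = guess-path n ∷ʳ (_ , increase , inc)

  commit-path : ∀ n → Path x 0 (guess , 0) (suc n) (wait , n)
  commit-path n = guess-path n ∷ʳ (_ , commit , stay)

  idle-path : ∀ {q c t t′} → Idle q → t ≤′ t′ →
              ∃[ q′ ] Idle q′ × Path x t (q , c) t′ (q′ , c)
  idle-path i ≤′-refl = _ , i , []
  idle-path i (≤′-step t≤t′) with idle-path i t≤t′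
  ... | _ , i′ , p = _ , wait , p ∷ʳ (_ , skip i′ , stay)

  -- Infinite runs from finite paths

  module _ (P : ℕ → ℕ → Set)
    (extend : ∀ {t c} → P t c →
       ∃₂ λ t′ c′ → t ≤ t′ × Path x t (done , c) (suc t′) (done , c′) × P (suc t′) c′)
    where

    private
      -- The path is the piece still to be walked before the next visit of `done`. Once it is used
      -- up, `extend` supplies another, nonempty because it ends at `suc t′` with `t ≤ t′`.
      record Stage (t : ℕ) : Set where
        constructor stage
        field
          {κ}      : Config 𝒜
          {t′ c′}  : ℕ
          path     : Path x t κ t′ (done , c′)
          property : P t′ c′

      advance : ∀ {t} (s : Stage t) →
                ∃ λ (s′ : Stage (suc t)) → x t ⊢ Stage.κ s ⟶ Stage.κ s′
      advance (stage (s ∷ p) h) = stage p h , s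
      advance (stage [] h) with extend h
      ... | _ , _ , t≤t′ , p , h′ with uncons t≤t′ p
      ...   | _ , s , p′ = stage p′ h′ , s

    infinite-run : ∀ {t c} → Path x 0 (guess , 0) t (done , c) → P t c → L 𝒜 x
    infinite-run p₀ h₀ =
      (λ t → Stage.κ (stages t)) ,
      (refl , λ t → ⟶⇒Step (proj₂ (advance (stages t)))) ,
      done , (λ t → visit t (Stage.path (stages t)) (Stage.property (stages t)) refl) , refl
      where
      stages : ∀ t → Stage t
      stages zero    = stage p₀ h₀
      stages (suc t) = proj₁ (advance (stages t))

      -- Induction on the piece still to be walked: `stages` consumes one step of it per unit of
      -- time, until it stands at `done`.
      visit : ∀ t {κ t′ c′} (p : Path x t κ t′ (done , c′)) (h : P t′ c′) →
              stages t ≡ stage p h →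
              ∃[ m ] t ≤ m × proj₁ (Stage.κ (stages m)) ≡ done
      visit t []      h eq = t , ≤-refl , cong (λ s → proj₁ (Stage.κ s)) eq
      visit t (s ∷ p) h eq
        with visit (suc t) p h (cong (λ s → proj₁ (advance s)) eq)
      ... | m , t<m , d = m , <⇒≤ t<m , d

-- Membership in Σ⁰₃

-- The largest counters with which a run can be idle, resp. in the state use.
Greedy : Set
Greedy = ℕ × Maybe ℕ

-- `enter` forgets the old second component since a run in `use` dies there; `leave` takes the
-- better of skipping and finishing the block.
greedy-step : Letter → Greedy → Greedy
greedy-step enter (w , _)            = w , just w
greedy-step down  (w , just (suc u)) = w , just u
greedy-step down  (w , just zero)    = w , nothing
greedy-step down  (w , nothing)      = w , nothing
greedy-step up    (w , just u)       = w , just (suc u)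
greedy-step up    (w , nothing)      = w , nothing
greedy-step leave (w , just u)       = w ⊔ u , nothing
greedy-step leave (w , nothing)      = w , nothing

data Gain : Letter → Greedy → Set where
  gain : ∀ {w u} → w ≤ u → Gain leave (w , just u)

greedy : ℕ → Letter ^ω → ℕ → Greedy
greedy n x zero    = n , nothing
greedy n x (suc s) = greedy-step (x (s + suc n)) (greedy n x s)

-- A run with guess n enters the state wait at time suc n; the greedy strategy is
-- indexed by the time elapsed since then.
GainAt : ℕ → Letter ^ω → ℕ → Set
GainAt n x s = Gain (x (s + suc n)) (greedy n x s)

greedy-≈ : ∀ n {x y} s → x ≈[ s + suc n ] y → greedy n x s ≡ greedy n y s
greedy-≈ n zero    x≈y = refl
greedy-≈ n (suc s) x≈y = cong₂ greedy-step (x≈y _ ≤-refl)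
  (greedy-≈ n s λ i i<s → x≈y i (m<n⇒m<1+n i<s))

GainAt-≈ : ∀ n {x y} s → x ≈[ suc s + suc n ] y → GainAt n x s → GainAt n y s
GainAt-≈ n s x≈y = subst₂ Gain (x≈y _ ≤-refl)
  (greedy-≈ n s λ i i<s → x≈y i (m<n⇒m<1+n i<s))

-- Greedy counters are attained by runs

module _ {x : Letter ^ω} {t₀ : ℕ} {κ₀ : Config 𝒜} where

  Reachable : ℕ → Greedy → Set
  Reachable t (w , u) =
      (∃[ q ] Idle q × Path x t₀ κ₀ t (q , w))
    × All (λ v → Path x t₀ κ₀ t (use , v)) u

  private
    extend : ∀ {t a κ κ′} → x t ≡ a → Path x t₀ κ₀ t κ → a ⊢ κ ⟶ κ′ →
             Path x t₀ κ₀ (suc t) κ′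
    extend refl = _∷ʳ_

  reachable-step : ∀ {t} a → x t ≡ a → ∀ m →
                   Reachable t m → Reachable (suc t) (greedy-step a m)
  reachable-step a eq m ((_ , i , p) , r) = go a eq m p r
    where
    go : ∀ {t} a → x t ≡ a → ∀ m → Path x t₀ κ₀ t (_ , proj₁ m) →
         All (λ v → Path x t₀ κ₀ t (use , v)) (proj₂ m) →
         Reachable (suc t) (greedy-step a m)
    go enter eq (w , _) p r =
      (_ , wait , extend eq p (_ , skip i , stay)) , just (extend eq p (_ , start i , stay))
    go down eq (w , just (suc u)) p (just r) =
      (_ , wait , extend eq p (_ , skip i , stay)) , just (extend eq r (_ , lower , dec))
    go down eq (w , just zero) p r = (_ , wait , extend eq p (_ , skip i , stay)) , nothing
    go down eq (w , nothing)   p r = (_ , wait , extend eq p (_ , skip i , stay)) , nothing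
    go up eq (w , just u) p (just r) =
      (_ , wait , extend eq p (_ , skip i , stay)) , just (extend eq r (_ , raise , inc))
    go up eq (w , nothing) p r = (_ , wait , extend eq p (_ , skip i , stay)) , nothing
    go leave eq (w , nothing) p r = (_ , wait , extend eq p (_ , skip i , stay)) , nothing
    -- The maximum is attained either by skipping the block or by finishing it.
    go leave eq (w , just u) p (just r) with ⊔-sel w u
    ... | inj₁ w⊔u≡w rewrite w⊔u≡w = (_ , wait , extend eq p (_ , skip i , stay)) , nothing
    ... | inj₂ w⊔u≡u rewrite w⊔u≡u = (_ , done , extend eq r (_ , finish , stay)) , nothing

module _ {n : ℕ} {x : Letter ^ω} where

  greedy-reachable : ∀ {s s′ q w} → Idle q → greedy n x s ≡ (w , nothing) → s ≤′ s′ →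
                     Reachable {x} {s + suc n} {q , w} (s′ + suc n) (greedy n x s′)
  greedy-reachable i eq ≤′-refl rewrite eq = (_ , i , []) , nothing
  greedy-reachable i eq (≤′-step s≤s′) =
    reachable-step _ refl _ (greedy-reachable i eq s≤s′)

  -- At `s` no block is open, so all later greedy counters are reached from `(q , w)`. A gain means
  -- that finishing the block attains the maximum, so the path ends with the greedy counter and the
  -- lemma applies again.
  gain-path : ∀ {s s′ q w} → Idle q → greedy n x s ≡ (w , nothing) → s ≤ s′ → GainAt n x s′ →
              ∃[ w′ ] Path x (s + suc n) (q , w) (suc s′ + suc n) (done , w′)
                    × greedy n x (suc s′) ≡ (w′ , nothing)
  gain-path {s′ = s′} i eq s≤s′ g =
    finish-path refl (greedy-reachable i eq (≤⇒≤′ s≤s′)) g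
    where
    finish-path : ∀ {t κ a m} → x (s′ + suc n) ≡ a →
                  Reachable {x} {t} {κ} (s′ + suc n) m → Gain a m →
                  ∃[ w′ ] Path x t κ (suc s′ + suc n) (done , w′)
                        × greedy-step a m ≡ (w′ , nothing)
    finish-path a≡ (_ , just p) (gain w≤u) =
      _ , p ∷ʳ subst (λ a → a ⊢ _ ⟶ _) (sym a≡) (_ , finish , stay) ,
      cong (_, nothing) (m≤n⇒m⊔n≡n w≤u)

  gains⇒L : Infinitely (GainAt n x) → L 𝒜 x
  gains⇒L gains with gains 0
  ... | s , 0≤s , g with gain-path wait refl 0≤s g
  ...   | c , p , eq = infinite-run
    -- Invariant at the visits of `done`: the run holds the greedy counter and no block is open.
    (λ t c → ∃[ s ] t ≡ s + suc n × greedy n x s ≡ (c , nothing))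
    (λ { (s , refl , eq) →
         let s′ , s≤s′ , g    = gains s
             c′ , p    , eq′  = gain-path done eq s≤s′ g
         in s′ + suc n , c′ , +-monoˡ-≤ (suc n) s≤s′ , p , suc s′ , refl , eq′ })
    (commit-path n ++ p) (suc s , refl , eq)

greedy-step-≤ : ∀ a m → proj₁ m ≤ proj₁ (greedy-step a m)
greedy-step-≤ enter m                  = ≤-refl
greedy-step-≤ down  (w , just (suc u)) = ≤-refl
greedy-step-≤ down  (w , just zero)    = ≤-refl
greedy-step-≤ down  (w , nothing)      = ≤-refl
greedy-step-≤ up    (w , just u)       = ≤-refl
greedy-step-≤ up    (w , nothing)      = ≤-refl
greedy-step-≤ leave (w , just u)       = m≤m⊔n w u
greedy-step-≤ leave (w , nothing)      = ≤-refl

-- Greedy counters bound all runs; descent without gains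

data Dominated : Config 𝒜 → Greedy → Set where
  idle  : ∀ {q c w u} → Idle q → c ≤ w → Dominated (q , c) (w , u)
  active : ∀ {c w v} → c ≤ v → Dominated (use , c) (w , just v)

-- The greedy counter, being at least as large, survives every `down` that the run survives.
dominated-step : ∀ {a κ κ′} m → a ⊢ κ ⟶ κ′ →
                 Dominated κ m → Dominated κ′ (greedy-step a m)
dominated-step _ (_ , increase , inc) (idle () _)
dominated-step _ (_ , commit , stay)  (idle () _)
dominated-step {a} m (_ , skip _ , stay) (idle _ c≤w) =
  idle wait (≤-trans c≤w (greedy-step-≤ a m))
dominated-step _ (_ , start _ , stay) (idle _ c≤w)      = active c≤w
dominated-step _ (_ , lower , dec)    (active (s≤s c≤v)) = active c≤v
dominated-step _ (_ , raise , inc)    (active c≤v)       = active (s≤s c≤v)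
dominated-step (w , just v) (_ , finish , stay) (active c≤v) =
  idle done (≤-trans c≤v (m≤n⊔m w v))

-- φ is the counter at the beginning of the block in use: within the block, run
-- and greedy strategy undergo the same changes, whence c − φ = v − w.
data Losing (φ : ℕ) : Config 𝒜 → Greedy → Set where
  idle  : ∀ {q w u} → Idle q → φ ≤ w → Losing φ (q , φ) (w , u)
  active : ∀ {c w v} → φ ≤ w → c + w ≡ φ + v → Losing φ (use , c) (w , just v)

dominated⇒losing : ∀ {κ m} → Dominated κ m → proj₁ κ ≡ done → ∃[ φ ] Losing φ κ m
dominated⇒losing (idle i c≤w) _ = _ , idle i c≤w

-- Within a block `φ` is kept. If the run finishes a block without a gain, then `v < w`, and
-- `c + w ≡ φ + v` yields `c < φ`; this `c` is the new `φ`.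
losing-step : ∀ {a κ κ′ φ} m → ¬ Gain a m → a ⊢ κ ⟶ κ′ → Losing φ κ m →
              ∃[ φ′ ] φ′ ≤ φ × (proj₁ κ′ ≡ done → φ′ < φ) × Losing φ′ κ′ (greedy-step a m)
losing-step _ _ (_ , increase , inc) (idle () _)
losing-step _ _ (_ , commit , stay)  (idle () _)
losing-step {a} m _ (_ , skip _ , stay) (idle _ φ≤w) =
  _ , ≤-refl , (λ ()) , idle wait (≤-trans φ≤w (greedy-step-≤ a m))
losing-step _ _ (_ , start _ , stay) (idle _ φ≤w) =
  _ , ≤-refl , (λ ()) , active φ≤w refl
-- The greedy counter cannot be exhausted first: that would give `suc c + w ≡ φ ≤ w`.
losing-step {φ = φ} (w , just zero) _ (_ , lower , dec {c}) (active φ≤w eq) =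
  contradiction (begin-strict
    w           ≤⟨ m≤n+m w c ⟩
    c + w       <⟨ n<1+n _ ⟩
    suc (c + w) ≡⟨ eq ⟩
    φ + 0       ≡⟨ +-identityʳ φ ⟩
    φ           ≤⟨ φ≤w ⟩
    w           ∎) (<-irrefl refl)
  where open ≤-Reasoning
losing-step {φ = φ} (w , just (suc v)) _ (_ , lower , dec) (active φ≤w eq) =
  _ , ≤-refl , (λ ()) , active φ≤w (suc-injective (trans eq (+-suc φ v)))
losing-step {φ = φ} (w , just v) _ (_ , raise , inc) (active φ≤w eq) =
  _ , ≤-refl , (λ ()) , active φ≤w (trans (cong suc eq) (sym (+-suc φ v)))
losing-step {φ = φ} (w , just v) ¬g (_ , finish , stay {c}) (active φ≤w eq) =
  c , <⇒≤ c<φ , (λ _ → c<φ) , idle done (≤-trans (<⇒≤ c<φ) (≤-trans φ≤w (m≤m⊔n w v)))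
  where
  open ≤-Reasoning
  c<φ : c < φ
  c<φ = +-cancelʳ-< w c φ (begin-strict
    c + w ≡⟨ eq ⟩
    φ + v <⟨ +-monoʳ-< φ (≰⇒> (¬g ∘ gain)) ⟩
    φ + w ∎)

module _ {x : Letter ^ω} {ρ : ℕ → Config 𝒜} (run : IsRun 𝒜 x ρ)
         (visits : Infinitely λ t → proj₁ (ρ t) ≡ done) where

  ρ-step : ∀ t → x t ⊢ ρ t ⟶ ρ (suc t)
  ρ-step t = Step⇒⟶ (proj₂ run t)

  -- Each step in `guess` increments, so the guess `n` is committed at time `suc n`, which explains
  -- the offset in `greedy`.
  guessing : ∀ t → ρ t ≡ (guess , t) ⊎ ∃[ n ] ρ (suc n) ≡ (wait , n)
  guessing zero = inj₁ (proj₁ run)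
  guessing (suc t) with guessing t
  ... | inj₂ committed = inj₂ committed
  ... | inj₁ eq = first-step eq refl (ρ-step t)
    where
    first-step : ∀ {a κ κ′} → κ ≡ (guess , t) → ρ (suc t) ≡ κ′ → a ⊢ κ ⟶ κ′ →
                 κ′ ≡ (guess , suc t) ⊎ ∃[ n ] ρ (suc n) ≡ (wait , n)
    first-step refl eq′ (_ , increase , inc) = inj₁ refl
    first-step refl eq′ (_ , commit , stay)  = inj₂ (t , eq′)

  committed : ∃[ n ] ρ (suc n) ≡ (wait , n)
  committed with visits 0
  ... | t , _ , d with guessing t
  ...   | inj₂ c = c
  ...   | inj₁ eq with trans (sym d) (cong proj₁ eq)
  ...     | ()

  module _ {n : ℕ} (start-wait : ρ (suc n) ≡ (wait , n)) where

    visits-from : ∀ m → ∃[ s ] m ≤ s × proj₁ (ρ (s + suc n)) ≡ done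
    visits-from m with visits (m + suc n)
    ... | t , m+n≤t , d =
      t ∸ suc n , m+n≤o⇒m≤o∸n m m+n≤t ,
      subst (λ t → proj₁ (ρ t) ≡ done)
            (sym (m∸n+n≡m (≤-trans (m≤n+m (suc n) m) m+n≤t))) d

    dominated : ∀ s → Dominated (ρ (s + suc n)) (greedy n x s)
    dominated zero rewrite start-wait = idle wait ≤-refl
    dominated (suc s) = dominated-step _ (ρ-step (s + suc n)) (dominated s)

    module _ {m : ℕ} (no-gain : ∀ s → m ≤ s → ¬ GainAt n x s) where

      losing-later : ∀ {φ s s′} → m ≤ s → s ≤′ s′ →
                     Losing φ (ρ (s + suc n)) (greedy n x s) →
                     ∃[ φ′ ] φ′ ≤ φ × Losing φ′ (ρ (s′ + suc n)) (greedy n x s′)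
      losing-later m≤s ≤′-refl l = _ , ≤-refl , l
      losing-later m≤s (≤′-step {s″} s≤s″) l with losing-later m≤s s≤s″ l
      ... | φ′ , φ′≤φ , l′
        with losing-step _ (no-gain s″ (≤-trans m≤s (≤′⇒≤ s≤s″))) (ρ-step _) l′
      ...   | φ″ , φ″≤φ′ , _ , l″ = φ″ , ≤-trans φ″≤φ′ φ′≤φ , l″

      -- Infinite descent: `φ` never grows, and the next visit of `done` lowers it strictly.
      not-losing : ∀ {φ s} → Acc _<_ φ → m ≤ s → ¬ Losing φ (ρ (s + suc n)) (greedy n x s)
      not-losing {s = s} (acc rec) m≤s l with visits-from (suc s)
      ... | suc s′ , s≤s s≤s′ , d with losing-later m≤s (≤⇒≤′ s≤s′) l
      ...   | φ′ , φ′≤φ , l′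
        with losing-step _ (no-gain s′ (≤-trans m≤s s≤s′)) (ρ-step _) l′
      ...     | φ″ , _ , drop , l″ =
        not-losing (rec (<-≤-trans (drop d) φ′≤φ)) (≤-trans m≤s (m≤n⇒m≤1+n s≤s′)) l″

      gainless-absurd : ⊥
      gainless-absurd with visits-from m
      ... | s , m≤s , d with dominated⇒losing (dominated s) d
      ...   | φ , l = contradiction l (not-losing (<-wellFounded φ) m≤s)

-- The word of the reduction

-- Round `t` consists of the blocks `t`, ..., `0`, so block `k` occurs in every round from `k` on.
-- The index `j` counts the equal letters still to follow the current one.
data Phase : Set where
  opening    : (t k : ℕ) → Phase
  descending : (t k j : ℕ) → Phase
  ascending  : (t k j : ℕ) → Phase
  closing    : (t k : ℕ) → Phase

next : Phase → Phase
next (opening t k)            = descending t k k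
next (descending t k zero)    = ascending t k k
next (descending t k (suc j)) = descending t k j
next (ascending t k zero)     = closing t k
next (ascending t k (suc j))  = ascending t k j
next (closing t zero)         = opening (suc t) (suc t)
next (closing t (suc k))      = opening t k

phase : ℕ → Phase
phase zero    = opening 0 0
phase (suc p) = next (phase p)

round : Phase → ℕ
round (opening t _)      = t
round (descending t _ _) = t
round (ascending t _ _)  = t
round (closing t _)      = t

round-next : ∀ φ → round (next φ) ≡ round φ ⊎ round (next φ) ≡ suc (round φ)
round-next (opening t k)            = inj₁ refl
round-next (descending t k zero)    = inj₁ refl
round-next (descending t k (suc j)) = inj₁ refl
round-next (ascending t k zero)     = inj₁ refl
round-next (ascending t k (suc j))  = inj₁ refl
round-next (closing t zero)         = inj₂ refl
round-next (closing t (suc k))      = inj₁ refl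

-- For continuity: the letter at `p` will depend only on the first `suc p` input letters. It also
-- shows that late rounds lie at late positions.
round-phase-≤ : ∀ p → round (phase p) ≤ p
round-phase-≤ zero = z≤n
round-phase-≤ (suc p) with round-next (phase p)
... | inj₁ eq = ≤-trans (≤-reflexive eq) (m≤n⇒m≤1+n (round-phase-≤ p))
... | inj₂ eq = ≤-trans (≤-reflexive eq) (s≤s (round-phase-≤ p))

round-phase-mono : ∀ {p p′} → p ≤′ p′ → round (phase p) ≤ round (phase p′)
round-phase-mono ≤′-refl = ≤-refl
round-phase-mono (≤′-step {p′} p≤p′) with round-next (phase p′)
... | inj₁ eq = ≤-trans (round-phase-mono p≤p′) (≤-reflexive (sym eq))
... | inj₂ eq = ≤-trans (round-phase-mono p≤p′) (≤-trans (n≤1+n _) (≤-reflexive (sym eq)))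

Visited : Phase → Set
Visited φ = ∃[ p ] phase p ≡ φ

visited-next : ∀ {φ} → Visited φ → Visited (next φ)
visited-next (p , eq) = suc p , cong next eq

visited-ascending : ∀ {t k} j → Visited (descending t k j) → Visited (ascending t k k)
visited-ascending zero    = visited-next
visited-ascending (suc j) = visited-ascending j ∘ visited-next

visited-closing : ∀ {t k} j → Visited (ascending t k j) → Visited (closing t k)
visited-closing zero    = visited-next
visited-closing (suc j) = visited-closing j ∘ visited-next

visited-block : ∀ {t k} → Visited (opening t k) → Visited (next (closing t k))
visited-block {k = k} =
  visited-next ∘ visited-closing k ∘ visited-ascending k ∘ visited-next

visited-rows : ∀ {t} d {k} → Visited (opening t (d + k)) → Visited (opening t k)
visited-rows zero    = λ v → v
visited-rows (suc d) = visited-rows d ∘ visited-block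

visited-round : ∀ t → Visited (opening t t)
visited-round zero    = 0 , refl
-- Descend from row `t` to row `0`; the block there leads into the next round.
visited-round (suc t) = visited-block (visited-rows t
  (subst (λ k → Visited (opening t k)) (sym (+-identityʳ t)) (visited-round t)))

visited-opening : ∀ {t k} → k ≤ t → Visited (opening t k)
visited-opening {t} {k} k≤t = visited-rows (t ∸ k)
  (subst (λ k → Visited (opening t k)) (sym (m∸n+n≡m k≤t)) (visited-round t))

-- A block is spoilt by any last letter but leave, since enter has no transition
-- from use.
verdict : ∀ {A : Set} → Dec A → Letter
verdict (yes _) = leave
verdict (no _)  = down

verdict-yes : ∀ {A : Set} (d : Dec A) → A → verdict d ≡ leave
verdict-yes (yes _) _ = refl
verdict-yes (no ¬a) a = contradiction a ¬a

verdict-cong : ∀ {A B : Set} (d : Dec A) (e : Dec B) → (A → B) → (B → A) →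
               verdict d ≡ verdict e
verdict-cong (yes _) (yes _) _ _ = refl
verdict-cong (no _)  (no _)  _ _ = refl
verdict-cong (yes a) (no ¬b) f _ = contradiction (f a) ¬b
verdict-cong (no ¬a) (yes b) _ g = contradiction (g b) ¬a

-- Runs on the word of the reduction

module _ {R : ℕ → ℕ → Set} (R? : ∀ k t → Dec (R k t)) where

  letter : Phase → Letter
  letter (opening _ _)      = enter
  letter (descending _ _ _) = down
  letter (ascending _ _ _)  = up
  letter (closing t k)      = verdict (R? k t)

  layout : Letter ^ω
  layout p = letter (phase p)

  module _ {t₀ : ℕ} {κ₀ : Config 𝒜} {t k : ℕ} where

    private
      PathTo : ℕ → Config 𝒜 → Set
      PathTo = Path layout t₀ κ₀

      extend : ∀ {p φ κ κ′} → phase p ≡ φ → PathTo p κ → letter φ ⊢ κ ⟶ κ′ →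
               PathTo (suc p) κ′
      extend refl = _∷ʳ_

    descend-path : ∀ j {p} → phase p ≡ descending t k j → PathTo p (use , suc j) →
                   ∃[ p′ ] p ≤ p′ × phase p′ ≡ ascending t k k × PathTo p′ (use , 0)
    descend-path zero    eq π =
      _ , n≤1+n _ , cong next eq , extend eq π (_ , lower , dec)
    descend-path (suc j) eq π
      with descend-path j (cong next eq) (extend eq π (_ , lower , dec))
    ... | p′ , p<p′ , r = p′ , <⇒≤ p<p′ , r

    ascend-path : ∀ j {p c} → phase p ≡ ascending t k j → PathTo p (use , c) →
                  ∃[ p′ ] p ≤ p′ × phase p′ ≡ closing t k × PathTo p′ (use , c + suc j)
    ascend-path zero {p} {c} eq π =
      suc p , n≤1+n p , cong next eq ,
      subst (λ c → PathTo (suc p) (use , c)) (+-comm 1 c) (extend eq π (_ , raise , inc))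
    ascend-path (suc j) {c = c} eq π
      with ascend-path j (cong next eq) (extend eq π (_ , raise , inc))
    ... | p′ , p<p′ , eq′ , π′ =
      p′ , <⇒≤ p<p′ , eq′ ,
      subst (λ c → PathTo p′ (use , c)) (sym (+-suc c (suc j))) π′

    -- The counter `suc k` is spent exactly by the `suc k` letters `down` and restored by as many
    -- letters `up`.
    block-path : ∀ {p q} → R k t → Idle q → phase p ≡ opening t k → PathTo p (q , suc k) →
                 ∃[ p′ ] p ≤ p′ × PathTo (suc p′) (done , suc k)
    block-path r i eq π
      with descend-path k (cong next eq) (extend eq π (_ , start i , stay))
    ... | p₁ , p<p₁ , eq₁ , π₁ with ascend-path k eq₁ π₁
    ...   | p₂ , p₁≤p₂ , eq₂ , π₂ =
      p₂ , ≤-trans (<⇒≤ p<p₁) p₁≤p₂ ,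
      extend eq₂ π₂
        (subst (_⊢ (use , suc k) ⟶ (done , suc k))
               (sym (verdict-yes (R? k t) r)) (_ , finish , stay))

  module _ {k : ℕ} (rows : Infinitely (R k)) where

    next-block : ∀ {p q} → Idle q →
                 ∃[ p′ ] p ≤ p′ × Path layout p (q , suc k) (suc p′) (done , suc k)
    -- `k ≤ t` puts block `k` into round `t`, and `p ≤ t` puts that round at or after position `p`.
    next-block {p} i with rows (p ⊔ k)
    ... | t , p⊔k≤t , r with visited-opening (m⊔n≤o⇒n≤o p k p⊔k≤t)
    ...   | p₁ , eq = let
      p≤p₁ = ≤-trans (m⊔n≤o⇒m≤o p k p⊔k≤t)
               (subst (_≤ p₁) (cong round eq) (round-phase-≤ p₁))
      _ , i₁ , π₁       = idle-path i (≤⇒≤′ p≤p₁)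
      p₂ , p₁≤p₂ , π₂   = block-path r i₁ eq π₁
      in p₂ , ≤-trans p≤p₁ p₁≤p₂ , π₂

    recurring⇒L : L 𝒜 layout
    recurring⇒L with next-block wait
    ... | _ , _ , π = infinite-run (λ _ c → c ≡ suc k)
      (λ { refl → let p′ , p≤p′ , π′ = next-block done in p′ , _ , p≤p′ , π′ , refl })
      (commit-path (suc k) ++ π) refl

  -- `N` is the counter between blocks. The equations count the letters of the current block already
  -- read; `stray` is a run caught in `use` by a spoilt block, doomed at the coming `enter`.
  data Tracks (N : ℕ) : Config 𝒜 → Phase → Set where
    idle    : ∀ {q φ} → Idle q → Tracks N (q , N) φ
    stray   : ∀ {c t k} → Tracks N (use , c) (opening t k)
    falling : ∀ {c t k j} → c + k ≡ N + j → Tracks N (use , c) (descending t k j)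
    rising  : ∀ {c t k j} → k < N → c + suc j ≡ N → Tracks N (use , c) (ascending t k j)
    ready   : ∀ {t k} → k < N → Tracks N (use , N) (closing t k)

  tracks-step : ∀ {N κ κ′} φ → letter φ ⊢ κ ⟶ κ′ → Tracks N κ φ → Tracks N κ′ (next φ)
  tracks-step (opening t k) (_ , skip _ , stay) (idle _) = idle wait
  tracks-step (opening t k) (_ , start _ , stay) (idle _) = falling refl
  tracks-step (opening t k) (_ , increase , inc) (idle ())
  tracks-step (opening t k) (_ , skip () , _) stray
  tracks-step (opening t k) (_ , start () , _) stray
  tracks-step (descending t k j) (_ , skip _ , stay) (idle _) = idle wait
  -- The last `down` succeeds only from a positive counter, which forces `k < N`.
  tracks-step {N} (descending t k zero) (_ , lower , dec {c}) (falling eq) =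
    rising (≤-trans (s≤s (m≤n+m k c)) (≤-reflexive eq′)) (trans (+-suc c k) eq′)
    where
    eq′ : suc c + k ≡ N
    eq′ = trans eq (+-identityʳ N)
  tracks-step {N} (descending t k (suc j)) (_ , lower , dec) (falling eq) =
    falling (suc-injective (trans eq (+-suc N j)))
  tracks-step (ascending t k j) (_ , skip _ , stay) (idle _) = idle wait
  tracks-step (ascending t k j) (_ , increase , inc) (idle ())
  tracks-step (ascending t k j) (_ , skip () , _) (rising _ _)
  tracks-step (ascending t k zero) (_ , raise , inc {c}) (rising k<N refl)
    rewrite +-comm c 1 = ready k<N
  tracks-step (ascending t k (suc j)) (_ , raise , inc {c}) (rising k<N eq) =
    rising k<N (trans (sym (+-suc c (suc j))) eq)
  tracks-step (closing t k) s tr with R? k t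
  tracks-step (closing t k) (_ , skip _ , stay) (idle _) | yes _ = idle wait
  tracks-step (closing t k) (_ , finish , stay) (ready _) | yes _ = idle done
  tracks-step (closing t k) (_ , skip _ , stay) (idle _) | no _ = idle wait
  -- The cases on `k` let `next` compute; both lead to an `opening`.
  tracks-step (closing t zero) (_ , lower , dec) (ready _) | no _ = stray
  tracks-step (closing t (suc k)) (_ , lower , dec) (ready _) | no _ = stray

  finish-step : ∀ {N κ κ′} φ → letter φ ⊢ κ ⟶ κ′ → proj₁ κ′ ≡ done → Tracks N κ φ →
                ∃[ k ] k < N × R k (round φ)
  finish-step (opening _ _)      (_ , () , _) refl _
  finish-step (descending _ _ _) (_ , () , _) refl _
  finish-step (ascending _ _ _)  (_ , () , _) refl _
  finish-step (closing t k) s d tr with R? k t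
  finish-step (closing t k) (_ , finish , stay) refl (ready k<N) | yes r = k , k<N , r

  -- Let `N` be the counter at some visit of `done`. Every later completed block restores it, so
  -- only blocks `k < N` are used from then on.
  L⇒recurring : L 𝒜 layout → ∃[ N ] Infinitely λ t → ∃[ k ] k < N × R k t
  L⇒recurring (ρ , run , .done , visits , refl) with visits 0
  ... | T , _ , d = N , recurs
    where
    N : ℕ
    N = proj₂ (ρ T)

    tracks : ∀ {p} → T ≤′ p → Tracks N (ρ p) (phase p)
    tracks ≤′-refl = subst (λ q → Tracks N (q , N) (phase T)) (sym d) (idle done)
    tracks (≤′-step T≤p) = tracks-step _ (Step⇒⟶ (proj₂ run _)) (tracks T≤p)

    recurs : Infinitely λ t → ∃[ k ] k < N × R k t
    recurs m with visited-round m
    -- The `suc` makes this visit the target of a step taken after `T` and after the start of round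
    -- `m`.
    ... | P , eq with visits (suc (T ⊔ P))
    ...   | suc p , s≤s T⊔P≤p , d′ =
      round (phase p) ,
      subst (_≤ round (phase p)) (cong round eq)
        (round-phase-mono (≤⇒≤′ (m⊔n≤o⇒n≤o T P T⊔P≤p))) ,
      finish-step _ (Step⇒⟶ (proj₂ run p)) d′ (tracks (≤⇒≤′ (m⊔n≤o⇒m≤o T P T⊔P≤p)))

-- Classical arguments: Borel class and hardness

module _ (em : ExcludedMiddle 0ℓ) where

  L-Σ⁰₃ : Σ⁰ 3 (L 𝒜)
  L-Σ⁰₃ = union (λ n x → Infinitely (GainAt n x)) gains-Π⁰₂
    ( (λ { (ρ , run , .done , visits , refl) →
           let n , eq = committed run visits in n , infinitely-gains run visits eq })
    , λ (n , gains) → gains⇒L gains )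
    where
    gains-Π⁰₂ : ∀ n → Π⁰ 2 (λ x → Infinitely (GainAt n x))
    gains-Π⁰₂ n = intersection _
      (λ m → open-set λ x (s , m≤s , g) →
        -- A gain at `s` is decided by the letters up to position `s + suc n` inclusive.
        suc s + suc n , λ y x≈y → s , m≤s , GainAt-≈ n s x≈y g)
      ((λ h → h) , λ h → h)

    infinitely-gains : ∀ {x ρ n} (run : IsRun 𝒜 x ρ) (visits : In 𝒜 ρ done) →
                       ρ (suc n) ≡ (wait , n) → Infinitely (GainAt n x)
    infinitely-gains {x} {n = n} run visits eq m with em {∃[ s ] m ≤ s × GainAt n x s}
    ... | yes g = g
    ... | no ¬g = ⊥-elim (gainless-absurd run visits eq λ s m≤s g → ¬g (s , m≤s , g))

  -- Induction on `N`: either the top row recurs, or past its bound only the smaller rows are left.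
  pigeonhole : ∀ (R : ℕ → ℕ → Set) N → (Infinitely λ t → ∃[ k ] k < N × R k t) →
               ∃[ k ] Infinitely (R k)
  pigeonhole R zero h with h 0
  ... | _ , _ , _ , () , _
  pigeonhole R (suc N) h with em {∃[ m ] (∀ t → m ≤ t → ¬ R N t)}
  ... | no ¬bounded = N , infinite
    where
    infinite : Infinitely (R N)
    infinite m with em {∃[ t ] m ≤ t × R N t}
    ... | yes r = r
    ... | no ¬r = contradiction (m , λ t m≤t r → ¬r (t , m≤t , r)) ¬bounded
  ... | yes (m₀ , bounded) = pigeonhole R N smaller
    where
    smaller : Infinitely λ t → ∃[ k ] k < N × R k t
    smaller m with h (m ⊔ m₀)
    ... | t , m⊔m₀≤t , k , s≤s k≤N , r with m≤n⇒m<n∨m≡n k≤N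
    ...   | inj₁ k<N  = t , m⊔n≤o⇒m≤o m m₀ m⊔m₀≤t , k , k<N , r
    ...   | inj₂ refl = contradiction r (bounded t (m⊔n≤o⇒n≤o m m₀ m⊔m₀≤t))

  -- Walk back from `d + m` to the first failure of `P`.
  first-change : ∀ (P : ℕ → Set) {m} d → ¬ P m → P (d + m) →
                 ∃[ t ] m ≤ t × ¬ P t × P (suc t)
  first-change P zero ¬p p = contradiction p ¬p
  first-change P {m} (suc d) ¬p p with em {P (d + m)}
  ... | yes p′ = first-change P d ¬p p′
  ... | no ¬p′ = d + m , m≤n+m m d , ¬p′ , p

  -- Membership in an intersection of open sets as recurring changes

  module _ {Y : Set} where

    ≈-sym : ∀ {n} {y z : Y ^ω} → y ≈[ n ] z → z ≈[ n ] y
    ≈-sym y≈z i i<n = sym (y≈z i i<n)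

    ≈-trans : ∀ {n} {x y z : Y ^ω} → x ≈[ n ] y → y ≈[ n ] z → x ≈[ n ] z
    ≈-trans x≈y y≈z i i<n = trans (x≈y i i<n) (y≈z i i<n)

    ≈-mono : ∀ {m n} {y z : Y ^ω} → m ≤ n → y ≈[ n ] z → y ≈[ m ] z
    ≈-mono m≤n y≈z i i<m = y≈z i (<-≤-trans i<m m≤n)

    module _ (C : ℕ → ωLanguage Y) where

      -- The cylinder of length `t` around `y` lies in `C 0`, ..., `C l`. Taking all `i ≤ l` makes
      -- the condition weaker for smaller `l`.
      Forced : ℕ → ℕ → Y ^ω → Set
      Forced l t y = ∀ i → i ≤ l → ∀ z → y ≈[ t ] z → C i z

      -- By l < t, no l is settled from the outset, and infinitely many changes
      -- happen even if the C l are trivial.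
      Settled : ℕ → ℕ → Y ^ω → Set
      Settled l t y = l < t × Forced l t y

      ChangeAt : ℕ → ℕ → Y ^ω → Set
      ChangeAt l t y = ¬ Settled l t y × Settled l (suc t) y

      Change : ℕ → Y ^ω → Set
      Change t y = ∃[ l ] ChangeAt l t y

      Forced-mono : ∀ {l t t′ y} → t ≤ t′ → Forced l t y → Forced l t′ y
      Forced-mono t≤t′ f i i≤l z y≈z = f i i≤l z (≈-mono t≤t′ y≈z)

      Settled-mono : ∀ {l t t′ y} → t ≤ t′ → Settled l t y → Settled l t′ y
      Settled-mono t≤t′ (l<t , f) = <-≤-trans l<t t≤t′ , Forced-mono t≤t′ f

      Settled-anti : ∀ {l l′ t y} → l ≤ l′ → Settled l′ t y → Settled l t y
      Settled-anti l≤l′ (l′<t , f) = ≤-<-trans l≤l′ l′<t , λ i i≤l → f i (≤-trans i≤l l≤l′)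

      Settled-≈ : ∀ {l t y z} → y ≈[ t ] z → Settled l t y → Settled l t z
      Settled-≈ y≈z (l<t , f) = l<t , λ i i≤l z′ z≈z′ → f i i≤l z′ (≈-trans y≈z z≈z′)

      Change-≈ : ∀ {t y z} → y ≈[ suc t ] z → Change t y → Change t z
      Change-≈ y≈z (l , ¬s , s) =
        l , ¬s ∘ Settled-≈ (≈-sym (≈-mono (n≤1+n _) y≈z)) , Settled-≈ y≈z s

      module _ {y : Y ^ω} where

        forced : (∀ l → Open (C l)) → (∀ l → C l y) → ∀ l → ∃[ t ] Forced l t y
        forced C-open y∈C zero with C-open 0 y (y∈C 0)
        ... | t , nbhd = t , λ { .zero z≤n z y≈z → nbhd z y≈z }
        forced C-open y∈C (suc l) with forced C-open y∈C l | C-open (suc l) y (y∈C (suc l))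
        ... | t , f | t′ , nbhd = t ⊔ t′ , f′
          where
          f′ : Forced (suc l) (t ⊔ t′) y
          f′ i i≤1+l z y≈z with m≤n⇒m<n∨m≡n i≤1+l
          ... | inj₁ (s≤s i≤l) = f i i≤l z (≈-mono (m≤m⊔n t t′) y≈z)
          ... | inj₂ refl      = nbhd z (≈-mono (m≤n⊔m t t′) y≈z)

        ⋂⇒changes : (∀ l → Open (C l)) → (∀ l → C l y) → Infinitely λ t → Change t y
        ⋂⇒changes C-open y∈C m with forced C-open y∈C m
        -- Index `m` cannot be settled at time `m`, as that needs `m < m`; hence its change comes at
        -- `m` or later.
        ... | t , f with first-change (λ t → Settled m t y) (suc t)
                          (λ (m<m , _) → <-irrefl refl m<m)
                          (s≤s (m≤n+m m t) , Forced-mono (m≤n⇒m≤1+n (m≤m+n t m)) f)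
        ...   | t′ , m≤t′ , change = t′ , m≤t′ , m , change

        no-recurring-change : ∀ {l} → ¬ (Infinitely λ t → ChangeAt l t y)
        no-recurring-change h with h 0
        ... | t , _ , _ , s with h (suc t)
        ...   | t′ , t<t′ , ¬s , _ = ¬s (Settled-mono t<t′ s)

        -- If `l` were never settled, only indices below `l` could change. One of them would change
        -- infinitely often, but settled indices stay settled.
        changes⇒⋂ : (Infinitely λ t → Change t y) → ∀ l → C l y
        changes⇒⋂ changes l with em {∃[ t ] Settled l t y}
        ... | yes (_ , _ , f) = f l ≤-refl y λ _ _ → refl
        ... | no ¬settled =
          contradiction (proj₂ (pigeonhole _ l below)) no-recurring-change
          where
          below : Infinitely λ t → ∃[ k ] k < l × ChangeAt k t y
          below m with changes m
          ... | t , m≤t , k , change =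
            t , m≤t , k , ≰⇒> (λ l≤k → ¬settled (suc t , Settled-anti l≤k (proj₂ change))) , change

    module _ (C : ℕ → ℕ → ωLanguage Y) where

      reduction : Y ^ω → Letter ^ω
      reduction y = layout λ k t → em {Change (C k) t y}

      letter-≈ : ∀ φ {y z} → y ≈[ suc (round φ) ] z →
                 letter (λ k t → em {Change (C k) t y}) φ ≡
                 letter (λ k t → em {Change (C k) t z}) φ
      letter-≈ (opening _ _)      y≈z = refl
      letter-≈ (descending _ _ _) y≈z = refl
      letter-≈ (ascending _ _ _)  y≈z = refl
      letter-≈ (closing t k)      y≈z =
        verdict-cong em em (Change-≈ (C k) y≈z) (Change-≈ (C k) (≈-sym y≈z))

      reduction-continuous : Continuous reduction
      reduction-continuous U U-open y fy∈U with U-open (reduction y) fy∈U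
      -- The first `n` letters of the image depend only on the first `n` letters of `y`.
      ... | n , nbhd = n , λ z y≈z → nbhd (reduction z) λ p p<n →
        letter-≈ (phase p) (≈-mono (≤-trans (s≤s (round-phase-≤ p)) p<n) y≈z)

  Σ⁰₁⇒Open : ∀ {Y} {A : ωLanguage Y} → Σ⁰ 1 A → Open A
  Σ⁰₁⇒Open (open-set A-open) = A-open

  Π⁰₂⇒⋂ : ∀ {Y} {B : ωLanguage Y} → Π⁰ 2 B →
          ∃ λ (C : ℕ → ωLanguage Y) → (∀ l → Open (C l)) × B ≐ ⋂ ℕ C
  Π⁰₂⇒⋂ (intersection C C-Σ⁰₁ B≐⋂C) = C , (λ l → Σ⁰₁⇒Open (C-Σ⁰₁ l)) , B≐⋂C

  L-hard : Σ⁰-Hard 3 (L 𝒜)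
  L-hard Y _ _ E (union B B-Π⁰₂ (E⊆⋃B , ⋃B⊆E)) =
    reduction C , reduction-continuous C , E⊆ , ⊆E
    where
    C : ℕ → ℕ → ωLanguage Y
    C k = proj₁ (Π⁰₂⇒⋂ (B-Π⁰₂ k))

    E⊆ : ∀ {y} → E y → L 𝒜 (reduction C y)
    E⊆ y∈E with E⊆⋃B y∈E
    ... | k , y∈B = let _ , C-open , B⊆⋂C , _ = Π⁰₂⇒⋂ (B-Π⁰₂ k) in
      recurring⇒L _ (⋂⇒changes (C k) C-open (B⊆⋂C y∈B))

    ⊆E : ∀ {y} → L 𝒜 (reduction C y) → E y
    ⊆E y∈L with L⇒recurring _ y∈L
    ... | N , recurs with pigeonhole _ N recurs
    ...   | k , changes =
      ⋃B⊆E (k , proj₂ (proj₂ (proj₂ (Π⁰₂⇒⋂ (B-Π⁰₂ k)))) (changes⇒⋂ (C k) changes))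

theorem3p1 : ExcludedMiddle 0ℓ →
    ∃ λ (Σ : Set) → Finite Σ × AtLeastTwo Σ ×
    (∃ λ (𝒜 : BlindCounterAutomaton Σ) → Σ⁰-Complete 3 (L 𝒜))
theorem3p1 em =
  Letter , Letter-finite , (enter , leave , λ ()) , 𝒜 , L-hard em , L-Σ⁰₃ em
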